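{- There is a constant $C$ such that every program $P\in\mathcal P_2^n$ has at most $C\times 1.23651^n$ stable models, where $n$ is the number of atoms of $P$.
   Context: A clause is $p\leftarrow B$ (definite) or $\leftarrow B$ (a constraint), where $p$ is an atom and $B$ is a finite set of literals (atoms $a$ or negated atoms $\mathrm{not}(a)$). A propositional logic program is a finite set of clauses. $\mathcal P_2^n$ is the class of programs $P$ such that every clause of $P$ is definite, has at most 2 literals counting the head, and has no positive atoms in its body (purely negative), and $P$ contains no pair of dual clauses $a\leftarrow\mathrm{not}(b)$ and $b\leftarrow\mathrm{not}(a)$. $M\subseteq\mathit{At}(P)$ is a stable model of $P$ if $M$ is the least model of the Gelfond–Lifschitz reduct $P^M$, obtained by deleting every clause with some $\mathrm{not}(a)$, $a\in M$, in its body and deleting negated literals from the remaining clauses. -}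

module Defs where

open import Data.Nat using (ℕ; _≤_; _*_; _^_)
open import Data.Fin using (Fin)
open import Data.Fin.Subset using (Subset; _∈_; _∉_; _⊆_)
open import Data.Bool using (Bool; true; false; if_then_else_)
open import Data.Maybe using (Maybe; just; nothing)
open import Data.List using (List; []; _∷_; length; mapMaybe)
open import Data.List.Relation.Unary.All using (All)
open import Data.List.Relation.Unary.Any using (Any)
open import Data.List.Membership.Propositional using () renaming (_∈_ to _∈ₗ_)
open import Data.List.Relation.Unary.Unique.Propositional using (Unique)
open import Data.Vec using (lookup)
open import Data.Product using (_×_; ∃)
open import Relation.Binary.PropositionalEquality using (_≡_; _≢_)
open import Relation.Nullary using (¬_)

data Lit (n : ℕ) : Set where
  pos : Fin n → Lit n
  neg : Fin n → Lit n

-- A clause  p ← B  (head = just p)  or a constraint  ← B  (head = nothing).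
record Clause (n : ℕ) : Set where
  constructor _←_
  field
    head : Maybe (Fin n)
    body : List (Lit n)
open Clause public

Program : ℕ → Set
Program n = List (Clause n)

OccursIn : ∀ {n} → Fin n → Program n → Set
OccursIn a P = Any (λ c → head c ≡ just a ⊎' Any (λ l → l ≡ pos a ⊎' l ≡ neg a) (body c)) P
  where
  open import Data.Sum using () renaming (_⊎_ to _⊎'_)

record PClause (n : ℕ) : Set where
  constructor _⇐_
  field
    phead : Maybe (Fin n)
    pbody : List (Fin n)
open PClause public

mem : ∀ {n} → Fin n → Subset n → Bool
mem a M with lookup M a
... | Data.Fin.Subset.inside  = true
... | Data.Fin.Subset.outside = false
  where import Data.Fin.Subset

blocked : ∀ {n} → Subset n → List (Lit n) → Bool
blocked M [] = false
blocked M (pos a ∷ B) = blocked M B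
blocked M (neg a ∷ B) = if mem a M then true else blocked M B

positives : ∀ {n} → List (Lit n) → List (Fin n)
positives [] = []
positives (pos a ∷ B) = a ∷ positives B
positives (neg a ∷ B) = positives B

reductClause : ∀ {n} → Subset n → Clause n → Maybe (PClause n)
reductClause M (h ← B) = if blocked M B then nothing else just (h ⇐ positives B)

reduct : ∀ {n} → Subset n → Program n → List (PClause n)
reduct M P = mapMaybe (reductClause M) P

HeadHolds : ∀ {n} → Maybe (Fin n) → Subset n → Set
HeadHolds (just p) X = p ∈ X
HeadHolds nothing  X = ⊥'
  where open import Data.Empty using () renaming (⊥ to ⊥')

ModelC : ∀ {n} → Subset n → PClause n → Set
ModelC X (h ⇐ B) = All (_∈ X) B → HeadHolds h X

ModelP : ∀ {n} → Subset n → List (PClause n) → Set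
ModelP X Q = All (ModelC X) Q

LeastModel : ∀ {n} → Subset n → List (PClause n) → Set
LeastModel M Q = ModelP M Q × (∀ X → ModelP X Q → M ⊆ X)

Stable : ∀ {n} → Program n → Subset n → Set
Stable P M = LeastModel M (reduct M P)

InClassClause : ∀ {n} → Clause n → Set
InClassClause (nothing ← B) = ⊥'
  where open import Data.Empty using () renaming (⊥ to ⊥')
InClassClause (just p ← B) = length B ≤ 1 × All (λ l → ∃ λ a → l ≡ neg a) B

NoDualPair : ∀ {n} → Program n → Set
NoDualPair {n} P = ∀ (a b : Fin n) → a ≢ b →
  ¬ ((just a ← (neg b ∷ [])) ∈ₗ P × (just b ← (neg a ∷ [])) ∈ₗ P)

InP2n : ∀ {n} → Program n → Set
InP2n P = All InClassClause P × NoDualPair P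

-- All atoms of Fin n occur in P, i.e. At(P) = Fin n and n = |At(P)|.
AtomsExactly : ∀ {n} → Program n → Set
AtomsExactly {n} P = ∀ (a : Fin n) → OccursIn a P

{-# OPTIONS --safe #-}
-- Read the rules v ← not(u) as arcs u → v of an oriented graph. Once facts and atoms with v ←
-- not(v) are dropped (they lie in every stable model), the complement of a stable model is a kernel
-- K: independent, with every vertex outside K having a predecessor in K. Kernels containing v
-- restrict to kernels of the graph without the closed neighbourhood of v, and kernels avoiding v to
-- kernels of the graph without v, so it suffices to find branchings n − k₁, n − k₂, … with Σ x^kᵢ ≤
-- 1, where x = 100000/123651.
--
-- Sources and sinks do not branch; a vertex with one predecessor branches as (3,4), a vertex of
-- degree at least 7 as (1,8). If v has exactly two predecessors a and b, then v, a or b is in K.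
-- This gives the extremal (4,5,7), equivalent to x² + x⁵ ≤ 1, when v has degree 6, and (5,5,6) or
-- (4,5,7) when v has degree 5 and a or b has degree at least 4. If none of these apply, discharging
-- shows that all vertices have in-degree = out-degree ∈ {2,3}, and then (5,5,6) or (7,7,7,7)
-- applies.
module Submission where

open import Defs
open import Data.Bool using (Bool; true; false; _∧_; _∨_; not)
open import Data.Bool.Properties using (∧-identityʳ; not-involutive; not-injective) renaming (_≟_ to _≟ᵇ_)
open import Data.Empty using (⊥; ⊥-elim)
open import Data.Fin using (Fin; zero; suc)
open import Data.Fin.Properties using (any?) renaming (_≟_ to _≟ᶠ_)
open import Data.Fin.Subset using (Subset)
import Data.Fin.Subset as Subset
open import Data.List using (List; []; _∷_; length; map; mapMaybe)
import Data.List.Membership.DecPropositional as DecMembership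
open import Data.List.Membership.Propositional using (_∈_; find; lose)
import Data.List.Properties as List
open import Data.List.Relation.Binary.Sublist.Propositional using (_⊆_; []; _∷_; _∷ʳ_)
open import Data.List.Relation.Binary.Sublist.Propositional.Properties using (All-resp-⊆)
open import Data.List.Relation.Unary.All using (All; []; _∷_)
import Data.List.Relation.Unary.All as All
import Data.List.Relation.Unary.All.Properties as All
open import Data.List.Relation.Unary.AllPairs using (AllPairs; []; _∷_)
import Data.List.Relation.Unary.AllPairs.Properties as AllPairs
open import Data.List.Relation.Unary.Any using (here; there)
import Data.List.Relation.Unary.Any as Any
open import Data.List.Relation.Unary.Unique.Propositional using (Unique)
open import Data.Maybe using (Maybe; just; nothing)
import Data.Maybe.Properties as Maybe
open import Data.Nat using (ℕ; zero; suc; _+_; _*_; _^_; _∸_; _≤_; _<_; z≤n; s≤s; s≤s⁻¹; NonZero; _≤?_)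
open import Data.Nat.Properties
open import Data.Nat.Solver using (module +-*-Solver)
open import Data.Product using (Σ; ∃; ∃₂; _×_; _,_; proj₁; proj₂)
open import Data.Sum using (_⊎_; inj₁; inj₂)
open import Data.Vec using (Vec; lookup; _[_]≔_)
open import Data.Vec.Properties using ([]=⇒lookup; lookup⇒[]=; lookup∘update; lookup∘update′; tabulate∘lookup; tabulate-cong)
open import Function using (_∘_; case_of_)
open import Relation.Binary.Definitions using (DecidableEquality)
open import Relation.Binary.PropositionalEquality
open import Relation.Nullary using (¬_; Dec; does; yes; no; contradiction)
open import Relation.Nullary.Decidable using (True; toWitness; _×-dec_; dec-true; dec-false; map′)
open import Algebra.Properties.CommutativeMonoid.Sum +-0-commutativeMonoid using (sum; sum-cong-≗; ∑-distrib-+; ∑-comm)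

-- Sums and cardinalities over Fin n

bit : Bool → ℕ
bit true  = 1
bit false = 0

∧-true : ∀ {x y} → x ∧ y ≡ true → x ≡ true × y ≡ true
∧-true {true} {true} _ = refl , refl

∧-intro : ∀ {x y} → x ≡ true → y ≡ true → x ∧ y ≡ true
∧-intro refl refl = refl

true≢false : ∀ {x} → x ≡ true → x ≡ false → ⊥
true≢false refl ()

not-false : ∀ {x} → x ≡ false → not x ≡ true
not-false refl = refl

not-true : ∀ {x} → not x ≡ true → x ≡ false
not-true {false} _ = refl

true⊎false : ∀ x → x ≡ true ⊎ x ≡ false
true⊎false true  = inj₁ refl
true⊎false false = inj₂ refl

does-true : ∀ {P : Set} (P? : Dec P) → does P? ≡ true → P
does-true (yes p) _ = p

sum-mono : ∀ {n} {f g : Fin n → ℕ} → (∀ i → f i ≤ g i) → sum f ≤ sum g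
sum-mono {zero}  f≤g = z≤n
sum-mono {suc n} f≤g = +-mono-≤ (f≤g zero) (sum-mono (f≤g ∘ suc))

sum-mono-< : ∀ {n} {f g : Fin n → ℕ} → (∀ i → f i ≤ g i) → ∀ j → f j < g j → sum f < sum g
sum-mono-< f≤g zero    lt = +-mono-<-≤ lt (sum-mono (f≤g ∘ suc))
sum-mono-< f≤g (suc j) lt = +-mono-≤-< (f≤g zero) (sum-mono-< (f≤g ∘ suc) j lt)

sum-scale : ∀ {n} c (f : Fin n → ℕ) → sum (λ i → c * f i) ≡ c * sum f
sum-scale {zero}  c f = sym (*-zeroʳ c)
sum-scale {suc n} c f = trans (cong (c * f zero +_) (sum-scale c (f ∘ suc)))
                              (sym (*-distribˡ-+ c (f zero) _))

♯ : ∀ {n} → (Fin n → Bool) → ℕ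
♯ p = sum (bit ∘ p)

bit-mono : ∀ {x y} → (x ≡ true → y ≡ true) → bit x ≤ bit y
bit-mono {false} h = z≤n
bit-mono {true}  h rewrite h refl = ≤-refl

♯-mono : ∀ {n} {p q : Fin n → Bool} → (∀ i → p i ≡ true → q i ≡ true) → ♯ p ≤ ♯ q
♯-mono h = sum-mono (λ i → bit-mono (h i))

♯-mono-< : ∀ {n} {p q : Fin n → Bool} → (∀ i → p i ≡ true → q i ≡ true) →
           ∀ j → p j ≡ false → q j ≡ true → ♯ p < ♯ q
♯-mono-< h j pj qj = sum-mono-< (λ i → bit-mono (h i)) j
  (subst₂ (λ x y → bit x < bit y) (sym pj) (sym qj) (s≤s z≤n))

♯≤n : ∀ {n} (p : Fin n → Bool) → ♯ p ≤ n
♯≤n {zero}  p = z≤n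
♯≤n {suc n} p = +-mono-≤ (bit≤1 (p zero)) (♯≤n (p ∘ suc))
  where
  bit≤1 : ∀ x → bit x ≤ 1
  bit≤1 true  = ≤-refl
  bit≤1 false = z≤n

_∖_ : ∀ {n} → (Fin n → Bool) → (Fin n → Bool) → Fin n → Bool
(p ∖ q) i = p i ∧ not (q i)

_∩_ : ∀ {n} → (Fin n → Bool) → (Fin n → Bool) → Fin n → Bool
(p ∩ q) i = p i ∧ q i

⁅_⁆ : ∀ {n} → Fin n → Fin n → Bool
⁅ a ⁆ i = does (i ≟ᶠ a)

⁅⁆-self : ∀ {n} (a : Fin n) → ⁅ a ⁆ a ≡ true
⁅⁆-self a = dec-true (a ≟ᶠ a) refl

⁅⁆-≡ : ∀ {n} {a : Fin n} i → ⁅ a ⁆ i ≡ true → i ≡ a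
⁅⁆-≡ {a = a} i = does-true (i ≟ᶠ a)

⁅⁆-≢ : ∀ {n} {a i : Fin n} → i ≢ a → ⁅ a ⁆ i ≡ false
⁅⁆-≢ {a = a} {i} = dec-false (i ≟ᶠ a)

♯-split : ∀ {n} (p q : Fin n → Bool) → ♯ p ≡ ♯ (p ∖ q) + ♯ (p ∩ q)
♯-split p q = trans (sum-cong-≗ (λ i → pointwise (p i) (q i))) (∑-distrib-+ (bit ∘ (p ∖ q)) (bit ∘ (p ∩ q)))
  where
  pointwise : ∀ x y → bit x ≡ bit (x ∧ not y) + bit (x ∧ y)
  pointwise true  true  = refl
  pointwise true  false = refl
  pointwise false _     = refl

♯⁅⁆ : ∀ {n} {p : Fin n → Bool} {a} → p a ≡ true → ♯ (p ∩ ⁅ a ⁆) ≡ 1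
♯⁅⁆ {p = p} {zero} pa rewrite pa = cong suc (vanish _ (λ i → ∧-falseʳ (p (suc i))))
  where
  ∧-falseʳ : ∀ x → x ∧ false ≡ false
  ∧-falseʳ true  = refl
  ∧-falseʳ false = refl
  vanish : ∀ {n} (q : Fin n → Bool) → (∀ i → q i ≡ false) → ♯ q ≡ 0
  vanish {zero}  q h = refl
  vanish {suc n} q h rewrite h zero = vanish (q ∘ suc) (h ∘ suc)
♯⁅⁆ {p = p} {suc a} pa with p zero
... | true  = ♯⁅⁆ {p = p ∘ suc} pa
... | false = ♯⁅⁆ {p = p ∘ suc} pa

♯-remove : ∀ {n} (p : Fin n → Bool) {a} → p a ≡ true → ♯ p ≡ suc (♯ (p ∖ ⁅ a ⁆))
♯-remove p {a} pa = trans (♯-split p ⁅ a ⁆) (trans (cong (♯ (p ∖ ⁅ a ⁆) +_) (♯⁅⁆ {p = p} pa)) (+-comm _ 1))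

♯>0 : ∀ {n} (p : Fin n → Bool) {a} → p a ≡ true → 1 ≤ ♯ p
♯>0 p pa = subst (1 ≤_) (sym (♯-remove p pa)) (s≤s z≤n)

♯>0⇒∃ : ∀ {n} (p : Fin n → Bool) → 1 ≤ ♯ p → ∃ λ a → p a ≡ true
♯>0⇒∃ {suc n} p h with p zero in eq
... | true  = zero , eq
... | false with ♯>0⇒∃ (p ∘ suc) h
...   | a , pa = suc a , pa

♯≡0⇒∉ : ∀ {n} (p : Fin n → Bool) → ♯ p ≡ 0 → ∀ a → p a ≡ true → ⊥
♯≡0⇒∉ p e a pa = case trans (sym e) (♯-remove p pa) of λ ()

2≤♯ : ∀ {n} (p : Fin n → Bool) {a b} → p a ≡ true → p b ≡ true → b ≢ a → 2 ≤ ♯ p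
2≤♯ p {a} pa pb b≢a = subst (2 ≤_) (sym (♯-remove p pa))
  (s≤s (♯>0 (p ∖ ⁅ a ⁆) (∧-intro pb (not-false (⁅⁆-≢ b≢a)))))

module _ {n : ℕ} (p : Fin n → Bool) where

  pick : ∀ {k} → ♯ p ≡ suc k →
         ∃ λ a → p a ≡ true × ♯ (p ∖ ⁅ a ⁆) ≡ k × (∀ x → p x ≡ true → x ≡ a ⊎ (p ∖ ⁅ a ⁆) x ≡ true)
  pick {k} e with ♯>0⇒∃ p (subst (1 ≤_) (sym e) (s≤s z≤n))
  ... | a , pa = a , pa , suc-injective (trans (sym (♯-remove p pa)) e) , other
    where
    other : ∀ x → p x ≡ true → x ≡ a ⊎ (p ∖ ⁅ a ⁆) x ≡ true
    other x px with x ≟ᶠ a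
    ... | yes x≡a = inj₁ x≡a
    ... | no  x≢a = inj₂ (trans (∧-identityʳ _) px)

∖-≢ : ∀ {n} {p : Fin n → Bool} {a x} → (p ∖ ⁅ a ⁆) x ≡ true → p x ≡ true × x ≢ a
∖-≢ {a = a} {x} h with ∧-true h
... | px , nx = px , λ { refl → true≢false (⁅⁆-self a) (not-true nx) }

module _ {n : ℕ} (p : Fin n → Bool) where

  exactly-one : ♯ p ≡ 1 → ∃ λ a → p a ≡ true × (∀ x → p x ≡ true → x ≡ a)
  exactly-one e with pick p e
  ... | a , pa , e₀ , h = a , pa , λ x px → case h x px of λ where
          (inj₁ x≡a) → x≡a
          (inj₂ q)   → ⊥-elim (♯≡0⇒∉ (p ∖ ⁅ a ⁆) e₀ x q)

  exactly-two : ♯ p ≡ 2 → ∃₂ λ a b → p a ≡ true × p b ≡ true × b ≢ a ×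
                (∀ x → p x ≡ true → x ≡ a ⊎ x ≡ b)
  exactly-two e with pick p e
  ... | a , pa , e₁ , h with pick (p ∖ ⁅ a ⁆) e₁
  ... | b , pb , e₀ , h′ with ∖-≢ {p = p} pb
  ... | pb′ , b≢a = a , b , pa , pb′ , b≢a , λ x px → case h x px of λ where
          (inj₁ x≡a) → inj₁ x≡a
          (inj₂ q)   → case h′ x q of λ where
            (inj₁ x≡b) → inj₂ x≡b
            (inj₂ r)   → ⊥-elim (♯≡0⇒∉ ((p ∖ ⁅ a ⁆) ∖ ⁅ b ⁆) e₀ x r)

  exactly-three : ♯ p ≡ 3 → ∃₂ λ a b → ∃ λ c → p a ≡ true × p b ≡ true × p c ≡ true ×
                  (∀ x → p x ≡ true → x ≡ a ⊎ x ≡ b ⊎ x ≡ c)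
  exactly-three e with pick p e
  ... | a , pa , e₂ , h with pick (p ∖ ⁅ a ⁆) e₂
  ... | b , pb , e₁ , h′ with pick ((p ∖ ⁅ a ⁆) ∖ ⁅ b ⁆) e₁
  ... | c , pc , e₀ , h″ =
      a , b , c , pa , proj₁ (∧-true pb) , proj₁ (∧-true {p c} (proj₁ (∧-true pc))) ,
      λ x px → case h x px of λ where
          (inj₁ x≡a) → inj₁ x≡a
          (inj₂ q)   → case h′ x q of λ where
            (inj₁ x≡b) → inj₂ (inj₁ x≡b)
            (inj₂ r)   → case h″ x r of λ where
              (inj₁ x≡c) → inj₂ (inj₂ x≡c)
              (inj₂ s)   → ⊥-elim (♯≡0⇒∉ (((p ∖ ⁅ a ⁆) ∖ ⁅ b ⁆) ∖ ⁅ c ⁆) e₀ x s)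

-- Families of vertex sets whose traces on S are pairwise distinct

Differ : ∀ {n} → (Fin n → Bool) → (K K′ : Fin n → Bool) → Set
Differ S K K′ = ¬ (∀ v → S v ≡ true → K v ≡ K′ v)

AllPairs-resp-⊆ : ∀ {a r} {X : Set a} {R : X → X → Set r} {xs ys : List X} →
                  xs ⊆ ys → AllPairs R ys → AllPairs R xs
AllPairs-resp-⊆ []         []       = []
AllPairs-resp-⊆ (_ ∷ʳ s)   (_ ∷ ps) = AllPairs-resp-⊆ s ps
AllPairs-resp-⊆ (refl ∷ s) (p ∷ ps) = All-resp-⊆ s p ∷ AllPairs-resp-⊆ s ps

-- Each element goes into exactly one list, even if both alternatives hold, so the lengths add up.
-- The parts are sublists so that they inherit pairwise difference.
distribute : ∀ {X : Set} {Q Q₁ Q₂ : X → Set} → (∀ {x} → Q x → Q₁ x ⊎ Q₂ x) → {xs : List X} → All Q xs →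
             ∃₂ λ ys zs → ys ⊆ xs × zs ⊆ xs × All Q₁ ys × All Q₂ zs × length xs ≡ length ys + length zs
distribute f [] = [] , [] , [] , [] , [] , [] , refl
distribute f {x ∷ xs} (q ∷ qs) with distribute f qs | f q
... | ys , zs , s , t , a , b , e | inj₁ q₁ =
  x ∷ ys , zs , refl ∷ s , x ∷ʳ t , q₁ ∷ a , b , cong suc e
... | ys , zs , s , t , a , b , e | inj₂ q₂ =
  ys , x ∷ zs , x ∷ʳ s , refl ∷ t , a , q₂ ∷ b , trans (cong suc e) (sym (+-suc _ _))

-- The branching weight (A/B)ᵏ, scaled by B⁸.
weight : ℕ → ℕ → ℕ → ℕ
weight A B k = A ^ k * B ^ (8 ∸ k)

-- Here `s` is the size of a subgraph that already satisfies the bound and `t` the size of the whole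
-- graph. Vertices removed beyond the required `k` only help, since `A ≤ B`; the condition `k ≤ 8`
-- lets `B ^ 8` split as `B ^ k * B ^ (8 ∸ k)`.
pow-slack : ∀ {A B} → A ≤ B → ∀ l s {k t} → k ≤ 8 → s + k ≤ t → l * A ^ s ≤ B ^ s →
            l * A ^ t * B ^ 8 ≤ B ^ t * weight A B k
pow-slack {A} {B} A≤B l s {k} {t} k≤8 s+k≤t h with m≤n⇒∃[o]m+o≡n s+k≤t
... | j , refl = begin
  l * A ^ (s + k + j) * B ^ 8
    ≡⟨ cong₂ (λ x y → l * x * y) (^-distrib₃ A) (trans (cong (B ^_) (sym (m+[n∸m]≡n k≤8))) (^-distribˡ-+-* B k (8 ∸ k))) ⟩
  l * (A ^ s * A ^ k * A ^ j) * (B ^ k * B ^ (8 ∸ k))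
    ≡⟨ solve 6 (λ l a b c d e → l :* (a :* b :* c) :* (d :* e) := l :* a :* (b :* c :* (d :* e))) refl
         l (A ^ s) (A ^ k) (A ^ j) (B ^ k) (B ^ (8 ∸ k)) ⟩
  l * A ^ s * (A ^ k * A ^ j * (B ^ k * B ^ (8 ∸ k)))
    ≤⟨ *-mono-≤ h (*-monoˡ-≤ _ (*-monoʳ-≤ (A ^ k) (^-monoˡ-≤ j A≤B))) ⟩
  B ^ s * (A ^ k * B ^ j * (B ^ k * B ^ (8 ∸ k)))
    ≡⟨ solve 5 (λ a b c d e → a :* (b :* c :* (d :* e)) := a :* d :* c :* (b :* e)) refl
         (B ^ s) (A ^ k) (B ^ j) (B ^ k) (B ^ (8 ∸ k)) ⟩
  B ^ s * B ^ k * B ^ j * (A ^ k * B ^ (8 ∸ k))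
    ≡⟨ cong (_* (A ^ k * B ^ (8 ∸ k))) (sym (^-distrib₃ B)) ⟩
  B ^ (s + k + j) * weight A B k ∎
  where
  open ≤-Reasoning
  open +-*-Solver
  ^-distrib₃ : ∀ X → X ^ (s + k + j) ≡ X ^ s * X ^ k * X ^ j
  ^-distrib₃ X = trans (^-distribˡ-+-* X (s + k) j) (cong (_* X ^ j) (^-distribˡ-+-* X s k))

AllPairs-map : ∀ {X : Set} {Q : X → Set} {R R′ : X → X → Set} →
               (∀ {x y} → Q x → Q y → R x y → R′ x y) →
               ∀ {xs} → All Q xs → AllPairs R xs → AllPairs R′ xs
AllPairs-map f []       []       = []
AllPairs-map f (q ∷ qs) (r ∷ rs) = All.zipWith (λ (qy , rxy) → f q qy rxy) (qs , r) ∷ AllPairs-map f qs rs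

-- Kernels of induced subgraphs

module Graph {n : ℕ} (E : Fin n → Fin n → Bool) (asym : ∀ {u v} → E u v ≡ true → E v u ≡ false) where

  -- Both conditions look at `K` on `S` only, so the same function can be passed unchanged to
  -- smaller vertex sets.
  record Kernel (S K : Fin n → Bool) : Set where
    field
      independent : ∀ {u v} → S u ≡ true → S v ≡ true → E u v ≡ true → K u ≡ true → K v ≡ false
      dominated   : ∀ {v} → S v ≡ true → K v ≡ false → ∃ λ u → S u ≡ true × E u v ≡ true × K u ≡ true
  open Kernel public

  irrefl : ∀ {v} → E v v ≡ false
  irrefl {v} with true⊎false (E v v)
  ... | inj₁ e = asym e
  ... | inj₂ e = e

  E⇒≢ : ∀ {u v} → E u v ≡ true → u ≢ v
  E⇒≢ e refl = true≢false e irrefl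

  adj : Fin n → Fin n → Bool
  adj v u = E u v ∨ E v u

  adj-cases : ∀ {u v} → adj v u ≡ true → E u v ≡ true ⊎ E v u ≡ true
  adj-cases {u} {v} h with E u v
  ... | true  = inj₁ refl
  ... | false = inj₂ h

  N : Fin n → Fin n → Bool
  N v u = ⁅ v ⁆ u ∨ adj v u

  N-cases : ∀ {v u} → N v u ≡ true → u ≡ v ⊎ adj v u ≡ true
  N-cases {v} {u} h with u ≟ᶠ v
  ... | yes u≡v = inj₁ u≡v
  ... | no  _   = inj₂ h

  adj⇒N : ∀ {v u} → adj v u ≡ true → N v u ≡ true
  adj⇒N {v} {u} h with ⁅ v ⁆ u
  ... | true  = refl
  ... | false = h

  N-self : ∀ v → N v v ≡ true
  N-self v rewrite ⁅⁆-self v = refl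

  E⇒N : ∀ {v u} → E v u ≡ true → N v u ≡ true
  E⇒N {v} {u} e = adj⇒N {v} {u} (lemma e)
    where
    lemma : E v u ≡ true → adj v u ≡ true
    lemma e with E u v
    ... | true  = refl
    ... | false = e

  kernel-adj : ∀ {S K v u} → Kernel S K → S v ≡ true → S u ≡ true → K v ≡ true → adj v u ≡ true → K u ≡ false
  kernel-adj {K = K} {v} {u} ker Sv Su Kv a with adj-cases {u} {v} a
  ... | inj₂ e = independent ker Sv Su e Kv
  ... | inj₁ e with true⊎false (K u)
  ...   | inj₂ Ku = Ku
  ...   | inj₁ Ku = ⊥-elim (true≢false Kv (independent ker Su Sv e Ku))

  -- Degrees and double counting of arcs

  pred succ : (Fin n → Bool) → Fin n → Fin n → Bool
  pred S v u = S u ∧ E u v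
  succ S v u = S u ∧ E v u

  indeg outdeg deg : (Fin n → Bool) → Fin n → ℕ
  indeg  S v = ♯ (pred S v)
  outdeg S v = ♯ (succ S v)
  deg    S v = indeg S v + outdeg S v

  -- Asymmetry makes predecessors and successors disjoint, so there are `deg S v` neighbours; `v`
  -- itself adds one.
  deg<♯N : ∀ {S v} → S v ≡ true → suc (deg S v) ≤ ♯ (S ∩ N v)
  deg<♯N {S} {v} Sv = subst (_< ♯ (S ∩ N v)) ♯adj (♯-mono-< inc v vertex (∧-intro Sv (N-self v)))
    where
    pointwise : ∀ x y z → (y ≡ true → z ≡ false) → bit (x ∧ (y ∨ z)) ≡ bit (x ∧ y) + bit (x ∧ z)
    pointwise false y     z     h = refl
    pointwise true  false z     h = refl
    pointwise true  true  true  h = case h refl of λ ()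
    pointwise true  true  false h = refl
    ♯adj : ♯ (S ∩ adj v) ≡ deg S v
    ♯adj = trans (sum-cong-≗ (λ u → pointwise (S u) (E u v) (E v u) asym)) (∑-distrib-+ (bit ∘ pred S v) (bit ∘ succ S v))
    inc : ∀ u → (S ∩ adj v) u ≡ true → (S ∩ N v) u ≡ true
    inc u h with ∧-true {S u} h
    ... | Su , a = ∧-intro Su (adj⇒N {v} {u} a)
    vertex : (S ∩ adj v) v ≡ false
    vertex rewrite irrefl {v} | Sv = refl

  sum-swap : (f g : Fin n → Fin n → ℕ) → (∀ u v → f u v ≡ g v u) →
             sum (λ u → sum (f u)) ≡ sum (λ v → sum (g v))
  sum-swap f g h = trans (∑-comm f) (sum-cong-≗ (λ v → sum-cong-≗ (λ u → h u v)))

  -- Both sides count the arcs inside `S`, by tail and by head.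
  handshake : ∀ S → sum (λ v → bit (S v) * outdeg S v) ≡ sum (λ v → bit (S v) * indeg S v)
  handshake S = begin
    sum (λ v → bit (S v) * outdeg S v)                     ≡⟨ sum-cong-≗ (λ v → sym (sum-scale (bit (S v)) (bit ∘ succ S v))) ⟩
    sum (λ v → sum (λ u → bit (S v) * bit (S u ∧ E v u)))  ≡⟨ sum-swap _ _ (λ v u → exchange (S v) (S u) (E v u)) ⟩
    sum (λ u → sum (λ v → bit (S u) * bit (S v ∧ E v u)))  ≡⟨ sum-cong-≗ (λ u → sum-scale (bit (S u)) (bit ∘ pred S u)) ⟩
    sum (λ v → bit (S v) * indeg S v)                      ∎
    where
    open ≡-Reasoning
    exchange : ∀ x y z → bit x * bit (y ∧ z) ≡ bit y * bit (x ∧ z)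
    exchange true  true  z = refl
    exchange true  false z = refl
    exchange false true  z = refl
    exchange false false z = refl

  -- Every vertex with in-degree 2 and out-degree 3 receives one unit from each of its two
  -- predecessors, which have in-degree 2 and out-degree 1; afterwards out-degrees are at most
  -- in-degrees, with total slack the number of (2,3)-vertices.
  module Discharging (S : Fin n → Bool)
    (ins : ∀ {v} → S v ≡ true → 2 ≤ indeg S v) (outs : ∀ {v} → S v ≡ true → 1 ≤ outdeg S v)
    (deg≤6 : ∀ {v} → S v ≡ true → deg S v ≤ 6)
    (deg≤5 : ∀ {v} → S v ≡ true → indeg S v ≡ 2 → deg S v ≤ 5)
    (deg≤3 : ∀ {v u} → S v ≡ true → indeg S v ≡ 2 → 5 ≤ deg S v → S u ≡ true → E u v ≡ true → deg S u ≤ 3)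
    where

    Heavy : Fin n → Bool
    Heavy v = S v ∧ (does (indeg S v ≟ 2) ∧ does (outdeg S v ≟ 3))

    given : Fin n → ℕ
    given u = ♯ (λ v → succ S u v ∧ Heavy v)

    heavy-degrees : ∀ {v} → Heavy v ≡ true → S v ≡ true × indeg S v ≡ 2 × outdeg S v ≡ 3
    heavy-degrees {v} h with ∧-true {S v} h
    ... | Sv , h′ with ∧-true h′
    ...   | p , q = Sv , does-true (indeg S v ≟ 2) p , does-true (outdeg S v ≟ 3) q

    heavy-intro : ∀ {v} → S v ≡ true → indeg S v ≡ 2 → outdeg S v ≡ 3 → Heavy v ≡ true
    heavy-intro {v} Sv p q = ∧-intro Sv (∧-intro (dec-true (indeg S v ≟ 2) p) (dec-true (outdeg S v ≟ 3) q))

    outdeg≤ : ∀ {v i j} → i ≤ indeg S v → deg S v ≤ i + j → outdeg S v ≤ j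
    outdeg≤ {v} {i} {j} i≤ d≤ = +-cancelˡ-≤ i _ _ (≤-trans (+-monoˡ-≤ (outdeg S v) i≤) d≤)

    -- With in-degree at least 3, `deg≤6` leaves out-degree at most 3. With in-degree 2, `deg≤5`
    -- does the same, and out-degree 3 is exactly the heavy case.
    unsent : ∀ {v} → S v ≡ true → outdeg S v ≤ indeg S v + bit (Heavy v)
    unsent {v} Sv with 3 ≤? indeg S v
    ... | yes 3≤in = ≤-trans (outdeg≤ 3≤in (deg≤6 Sv)) (≤-trans 3≤in (m≤m+n _ _))
    ... | no  3≰in with ≤-antisym (s≤s⁻¹ (≰⇒> 3≰in)) (ins Sv)
    ...   | in≡2 with outdeg S v ≟ 3
    ...     | no  out≢3 = ≤-trans (s≤s⁻¹ (≤∧≢⇒< (outdeg≤ (ins Sv) (deg≤5 Sv in≡2)) out≢3)) (≤-trans (ins Sv) (m≤m+n _ _))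
    ...     | yes out≡3 rewrite heavy-intro Sv in≡2 out≡3 | in≡2 = ≤-reflexive out≡3

    -- A vertex that gives anything has a heavy successor, so `deg≤3` leaves it out-degree at most
    -- 1. It then gives at most 1, and the left side is at most 2. A vertex that gives nothing is
    -- covered by `unsent`.
    charge : ∀ v → bit (S v) * outdeg S v + bit (S v) * given v ≤ bit (S v) * indeg S v + bit (Heavy v)
    charge v with true⊎false (S v)
    ... | inj₂ Sv rewrite Sv = z≤n
    ... | inj₁ Sv = subst (λ x → bit x * outdeg S v + bit x * given v ≤ bit x * indeg S v + bit (Heavy v)) (sym Sv)
        (subst₂ _≤_ (cong₂ _+_ (sym (*-identityˡ (outdeg S v))) (sym (*-identityˡ (given v))))
                    (cong (_+ bit (Heavy v)) (sym (*-identityˡ (indeg S v)))) charged)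
      where
      charged : outdeg S v + given v ≤ indeg S v + bit (Heavy v)
      charged with 1 ≤? given v
      ... | no  1≰g rewrite n<1⇒n≡0 (≰⇒> 1≰g) = subst (_≤ indeg S v + bit (Heavy v)) (sym (+-identityʳ _)) (unsent Sv)
      ... | yes 1≤g with ♯>0⇒∃ (λ x → succ S v x ∧ Heavy x) 1≤g
      ...   | x , h with ∧-true {succ S v x} h
      ...   | vx , Hx with ∧-true {S x} vx | heavy-degrees Hx
      ...   | Sx , e | _ , in≡2 , out≡3 = ≤-trans (+-mono-≤ out≤1 given≤1) (≤-trans (ins Sv) (m≤m+n _ _))
        where
        out≤1 : outdeg S v ≤ 1
        out≤1 = outdeg≤ (ins Sv) (deg≤3 Sx in≡2 (≤-reflexive (sym (cong₂ _+_ in≡2 out≡3))) Sv e)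
        given≤1 : given v ≤ 1
        given≤1 = ≤-trans (♯-mono (λ y hy → proj₁ (∧-true {succ S v y} hy))) out≤1

    -- Double counting of the arcs into heavy vertices, each of which has exactly two predecessors.
    total-given : sum (λ u → bit (S u) * given u) ≡ 2 * ♯ Heavy
    total-given = begin
      sum (λ u → bit (S u) * given u)
        ≡⟨ sum-cong-≗ (λ u → sym (sum-scale (bit (S u)) (λ v → bit (succ S u v ∧ Heavy v)))) ⟩
      sum (λ u → sum (λ v → bit (S u) * bit ((S v ∧ E u v) ∧ Heavy v)))
        ≡⟨ sum-swap _ _ (λ u v → exchange (S u) (S v) (E u v) (does (indeg S v ≟ 2) ∧ does (outdeg S v ≟ 3))) ⟩
      sum (λ v → sum (λ u → bit (Heavy v) * bit (S u ∧ E u v)))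
        ≡⟨ sum-cong-≗ (λ v → sum-scale (bit (Heavy v)) (bit ∘ pred S v)) ⟩
      sum (λ v → bit (Heavy v) * indeg S v)
        ≡⟨ sum-cong-≗ two ⟩
      sum (λ v → 2 * bit (Heavy v))
        ≡⟨ sum-scale 2 (bit ∘ Heavy) ⟩
      2 * ♯ Heavy ∎
      where
      open ≡-Reasoning
      exchange : ∀ x y z t → bit x * bit ((y ∧ z) ∧ (y ∧ t)) ≡ bit (y ∧ t) * bit (x ∧ z)
      exchange false false z     t     = refl
      exchange false true  z     false = refl
      exchange false true  z     true  = refl
      exchange true  false z     t     = refl
      exchange true  true  false false = refl
      exchange true  true  false true  = refl
      exchange true  true  true  false = refl
      exchange true  true  true  true  = refl
      two : ∀ v → bit (Heavy v) * indeg S v ≡ 2 * bit (Heavy v)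
      two v with true⊎false (Heavy v)
      ... | inj₂ h rewrite h = refl
      ... | inj₁ h = subst (λ x → bit x * indeg S v ≡ 2 * bit x) (sym h)
                       (trans (*-identityˡ (indeg S v)) (proj₁ (proj₂ (heavy-degrees h))))

    outs-total : ℕ
    outs-total = sum (λ v → bit (S v) * outdeg S v)

    -- Summing `charge` gives total out-degree plus `2 * ♯ Heavy` at most total in-degree plus
    -- `♯ Heavy`, and `handshake` cancels the degree sums.
    no-heavy : ♯ Heavy ≡ 0
    no-heavy = n≤0⇒n≡0 (+-cancelˡ-≤ (♯ Heavy) _ _ (+-cancelˡ-≤ outs-total _ _ (begin
      outs-total + (♯ Heavy + ♯ Heavy)
        ≡⟨ cong (λ x → outs-total + (♯ Heavy + x)) (sym (+-identityʳ (♯ Heavy))) ⟩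
      outs-total + 2 * ♯ Heavy
        ≡⟨ cong (outs-total +_) (sym total-given) ⟩
      outs-total + sum (λ v → bit (S v) * given v)
        ≡⟨ sym (∑-distrib-+ (λ v → bit (S v) * outdeg S v) (λ v → bit (S v) * given v)) ⟩
      sum (λ v → bit (S v) * outdeg S v + bit (S v) * given v)
        ≤⟨ sum-mono charge ⟩
      sum (λ v → bit (S v) * indeg S v + bit (Heavy v))
        ≡⟨ ∑-distrib-+ (λ v → bit (S v) * indeg S v) (bit ∘ Heavy) ⟩
      sum (λ v → bit (S v) * indeg S v) + ♯ Heavy
        ≡⟨ cong₂ _+_ (sym (handshake S)) (sym (+-identityʳ (♯ Heavy))) ⟩
      outs-total + (♯ Heavy + 0) ∎)))
      where open ≤-Reasoning

    outdeg≤indeg : ∀ {v} → S v ≡ true → outdeg S v ≤ indeg S v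
    outdeg≤indeg {v} Sv with true⊎false (Heavy v)
    ... | inj₁ h = ⊥-elim (♯≡0⇒∉ Heavy no-heavy v h)
    ... | inj₂ h = subst (outdeg S v ≤_) (trans (cong (λ x → indeg S v + bit x) h) (+-identityʳ _)) (unsent Sv)

    -- A strict inequality at one vertex would make the two sums of `handshake` differ.
    balanced : ∀ {v} → S v ≡ true → outdeg S v ≡ indeg S v
    balanced {v} Sv with outdeg S v ≟ indeg S v
    ... | yes e = e
    ... | no ≢ = ⊥-elim (<-irrefl (handshake S) (sum-mono-< pointwise v strict))
      where
      pointwise : ∀ u → bit (S u) * outdeg S u ≤ bit (S u) * indeg S u
      pointwise u with true⊎false (S u)
      ... | inj₂ Su rewrite Su = z≤n
      ... | inj₁ Su = *-monoʳ-≤ (bit (S u)) (outdeg≤indeg Su)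
      strict : bit (S v) * outdeg S v < bit (S v) * indeg S v
      strict = subst (λ x → bit x * outdeg S v < bit x * indeg S v) (sym Sv)
                 (*-monoʳ-< 1 (≤∧≢⇒< (outdeg≤indeg Sv) ≢))

  -- Counting kernels by branching

  module Branching (A B : ℕ) .{{_ : NonZero B}} (A≤B : A ≤ B)
    -- The subscripts list the numbers of vertices removed in the branches. Each hypothesis says
    -- that the powers of `A / B` with these exponents sum to at most 1, multiplied by `B ^ 8` to
    -- stay in the naturals.
    (w₁   : weight A B 1 ≤ B ^ 8)
    (w₃₄  : weight A B 3 + weight A B 4 ≤ B ^ 8)
    (w₁₈  : weight A B 1 + weight A B 8 ≤ B ^ 8)
    (w₇₄₅ : weight A B 7 + (weight A B 4 + weight A B 5) ≤ B ^ 8)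
    (w₅₅₆ : weight A B 5 + (weight A B 5 + weight A B 6) ≤ B ^ 8)
    (w₇₇₇₇ : weight A B 7 + (weight A B 7 + (weight A B 7 + weight A B 7)) ≤ B ^ 8) where

    -- In fractions: there are at most `(B / A) ^ ♯ S` kernels, counted by their traces on `S`.
    Good : (Fin n → Bool) → Set
    Good S = ∀ L → AllPairs (Differ S) L → All (Kernel S) L → length L * A ^ ♯ S ≤ B ^ ♯ S

    wt : ℕ → ℕ
    wt = weight A B

    -- In fractions: the sets with property `Q` use up at most the share `w / B ^ 8` of the bound in
    -- `Good`. The shares of the branches add up by `few-⊎`.
    Few : (Fin n → Bool) → ((Fin n → Bool) → Set) → ℕ → Set
    Few S Q w = ∀ L → AllPairs (Differ S) L → All Q L → length L * A ^ ♯ S * B ^ 8 ≤ B ^ ♯ S * w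

    few⇒good : ∀ {S w} → Few S (Kernel S) w → w ≤ B ^ 8 → Good S
    few⇒good {S} few w≤ L ps ks =
      *-cancelʳ-≤ _ _ (B ^ 8) {{m^n≢0 B 8}} (≤-trans (few L ps ks) (*-monoʳ-≤ (B ^ ♯ S) w≤))

    few-⊎ : ∀ {S Q Q₁ Q₂ w₁ w₂} → (∀ {K} → Q K → Q₁ K ⊎ Q₂ K) →
            Few S Q₁ w₁ → Few S Q₂ w₂ → Few S Q (w₁ + w₂)
    few-⊎ {S} {w₁ = w₁} {w₂} f few₁ few₂ L ps qs with distribute f qs
    ... | L₁ , L₂ , s₁ , s₂ , q₁ , q₂ , e = begin
      length L * a * b                        ≡⟨ cong (λ l → l * a * b) e ⟩
      (length L₁ + length L₂) * a * b         ≡⟨ cong (_* b) (*-distribʳ-+ a (length L₁) _) ⟩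
      (length L₁ * a + length L₂ * a) * b     ≡⟨ *-distribʳ-+ b (length L₁ * a) _ ⟩
      length L₁ * a * b + length L₂ * a * b   ≤⟨ +-mono-≤ (few₁ L₁ (AllPairs-resp-⊆ s₁ ps) q₁) (few₂ L₂ (AllPairs-resp-⊆ s₂ ps) q₂) ⟩
      B ^ ♯ S * w₁ + B ^ ♯ S * w₂             ≡⟨ sym (*-distribˡ-+ (B ^ ♯ S) w₁ w₂) ⟩
      B ^ ♯ S * (w₁ + w₂)                     ∎
      where
      open ≤-Reasoning
      a b : ℕ
      a = A ^ ♯ S
      b = B ^ 8

    few-∅ : ∀ {S Q w} → (∀ {K} → Q K → ⊥) → Few S Q w
    few-∅ absurd []      ps qs       = z≤n
    few-∅ absurd (_ ∷ _) ps (q ∷ qs) = ⊥-elim (absurd q)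

    few-map : ∀ {S Q Q′ w} → (∀ {K} → Q K → Q′ K) → Few S Q′ w → Few S Q w
    few-map f few L ps qs = few L ps (All.map f qs)

    w₇₅₄ : wt 7 + (wt 5 + wt 4) ≤ B ^ 8
    w₇₅₄ = subst (_≤ B ^ 8) (cong (wt 7 +_) (+-comm (wt 4) (wt 5))) w₇₄₅

    w₆₅₅ : wt 6 + (wt 5 + wt 5) ≤ B ^ 8
    w₆₅₅ = subst (_≤ B ^ 8) (trans (sym (+-assoc (wt 5) (wt 5) (wt 6))) (+-comm (wt 5 + wt 5) (wt 6))) w₅₅₆

    -- Induction on the number of vertices

    module Step (S : Fin n → Bool) (ih : ∀ S′ → ♯ S′ < ♯ S → Good S′) where

      -- Since the trace on `S′` determines the trace on `S`, sets that differ on `S` still differ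
      -- on `S′`, and the induction hypothesis for `S′` counts them. The condition `1 ≤ k` makes
      -- `S′` strictly smaller.
      reduce : ∀ {Q} S′ {k} → 1 ≤ k → k ≤ 8 → ♯ S′ + k ≤ ♯ S → (∀ {K} → Q K → Kernel S′ K) →
               (∀ {K K′} → Q K → Q K′ → (∀ v → S′ v ≡ true → K v ≡ K′ v) → ∀ v → S v ≡ true → K v ≡ K′ v) →
               Few S Q (wt k)
      reduce S′ {k} 1≤k k≤8 smaller ker determined L ps qs =
        pow-slack A≤B (length L) (♯ S′) k≤8 smaller
          (ih S′ (≤-trans (subst (_≤ ♯ S′ + k) (+-comm _ 1) (+-monoʳ-≤ (♯ S′) 1≤k)) smaller) L
            (AllPairs-map (λ q q′ d agree → d (determined q q′ agree)) qs ps) (All.map ker qs))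

      ♯-shrink : ∀ D {k} → k ≤ ♯ (S ∩ D) → ♯ (S ∖ D) + k ≤ ♯ S
      ♯-shrink D k≤ = subst (♯ (S ∖ D) + _ ≤_) (sym (♯-split S D)) (+-monoʳ-≤ (♯ (S ∖ D)) k≤)

      -- Membership is settled on the closed neighbourhoods of `v` and `w` and on the excluded set
      -- `X`; all of these are removed together. The case of a single pinned vertex takes `w` equal
      -- to `v`.
      module Pin {v w : Fin n} (Sv : S v ≡ true) (Sw : S w ≡ true) (X : Fin n → Bool)
                 {Q : (Fin n → Bool) → Set} (ker : ∀ {K} → Q K → Kernel S K)
                 (Kv : ∀ {K} → Q K → K v ≡ true) (Kw : ∀ {K} → Q K → K w ≡ true)
                 (KX : ∀ {K} x → Q K → X x ≡ true → K x ≡ false) where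

        D : Fin n → Bool
        D u = N v u ∨ (N w u ∨ X u)

        D-cases : ∀ {u} → D u ≡ true → N v u ≡ true ⊎ N w u ≡ true ⊎ X u ≡ true
        D-cases {u} h with N v u | N w u
        ... | true  | _     = inj₁ refl
        ... | false | true  = inj₂ (inj₁ refl)
        ... | false | false = inj₂ (inj₂ h)

        Nv⇒D : ∀ u → N v u ≡ true → D u ≡ true
        Nv⇒D u h with N v u
        ... | true = refl

        Nw⇒D : ∀ u → N w u ≡ true → D u ≡ true
        Nw⇒D u h with N v u | N w u
        ... | true  | _    = refl
        ... | false | true = refl

        X⇒D : ∀ u → X u ≡ true → D u ≡ true
        X⇒D u h with N v u | N w u
        ... | true  | _     = refl
        ... | false | true  = refl
        ... | false | false = h

        decided : ∀ {u} → S u ≡ true → D u ≡ true → (u ≡ v ⊎ u ≡ w) ⊎ (∀ {K} → Q K → K u ≡ false)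
        decided Su Du with D-cases Du
        decided Su Du | inj₁ Nv with N-cases Nv
        ... | inj₁ u≡v = inj₁ (inj₁ u≡v)
        ... | inj₂ a   = inj₂ λ q → kernel-adj (ker q) Sv Su (Kv q) a
        decided Su Du | inj₂ (inj₁ Nw) with N-cases Nw
        ... | inj₁ u≡w = inj₁ (inj₂ u≡w)
        ... | inj₂ a   = inj₂ λ q → kernel-adj (ker q) Sw Su (Kw q) a
        decided Su Du | inj₂ (inj₂ Xu) = inj₂ λ q → KX _ q Xu

        -- Needed for domination after the removal of `D`. A removed vertex that lies in `K` is `v`
        -- or `w`, and the successors of these are removed as well.
        outside : ∀ {K u x} → Q K → S u ≡ true → K u ≡ true → E u x ≡ true → D x ≡ false → D u ≡ false
        outside {u = u} {x} q Su Ku e Dx with true⊎false (D u)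
        ... | inj₂ Du = Du
        ... | inj₁ Du with decided Su Du
        ...   | inj₁ (inj₁ refl) = ⊥-elim (true≢false (Nv⇒D x (E⇒N e)) Dx)
        ...   | inj₁ (inj₂ refl) = ⊥-elim (true≢false (Nw⇒D x (E⇒N e)) Dx)
        ...   | inj₂ out         = ⊥-elim (true≢false Ku (out q))

        restrict : ∀ {K} → Q K → Kernel (S ∖ D) K
        restrict q .independent Su Sx = independent (ker q) (proj₁ (∧-true Su)) (proj₁ (∧-true Sx))
        restrict q .dominated {x} Sx Kx with ∧-true {S x} Sx
        ... | Sx′ , Dx with dominated (ker q) Sx′ Kx
        ... | u , Su , e , Ku = u , ∧-intro Su (not-false (outside q Su Ku e (not-true Dx))) , e , Ku

        determined : ∀ {K K′} → Q K → Q K′ → (∀ u → (S ∖ D) u ≡ true → K u ≡ K′ u) →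
                     ∀ u → S u ≡ true → K u ≡ K′ u
        determined q q′ agree u Su with true⊎false (D u)
        ... | inj₂ Du = agree u (∧-intro Su (not-false Du))
        ... | inj₁ Du with decided Su Du
        ...   | inj₁ (inj₁ refl) = trans (Kv q) (sym (Kv q′))
        ...   | inj₁ (inj₂ refl) = trans (Kw q) (sym (Kw q′))
        ...   | inj₂ out         = trans (out q) (sym (out q′))

        S∩N⇒S∩D : ∀ u → (S ∩ N v) u ≡ true → (S ∩ D) u ≡ true
        S∩N⇒S∩D u h with ∧-true {S u} h
        ... | Su , Nu = ∧-intro Su (Nv⇒D u Nu)

        few : ∀ {k} → 1 ≤ k → k ≤ 8 → k ≤ suc (deg S v) → Few S Q (wt k)
        few 1≤k k≤8 k≤ = reduce (S ∖ D) 1≤k k≤8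
          (♯-shrink D (≤-trans k≤ (≤-trans (deg<♯N Sv) (♯-mono S∩N⇒S∩D)))) restrict determined

        -- The removed vertex `y` comes on top of the at least `1 + deg S v` vertices of the closed
        -- neighbourhood of `v`.
        few-extra : ∀ {k y} → S y ≡ true → D y ≡ true → N v y ≡ false →
                    1 ≤ k → k ≤ 8 → k ≤ 2 + deg S v → Few S Q (wt k)
        few-extra {y = y} Sy Dy Ny 1≤k k≤8 k≤ = reduce (S ∖ D) 1≤k k≤8
          (♯-shrink D (≤-trans k≤ (≤-trans (s≤s (deg<♯N Sv))
            (♯-mono-< S∩N⇒S∩D y (cong₂ _∧_ Sy Ny) (∧-intro Sy Dy))))) restrict determined

      In : Fin n → (Fin n → Bool) → Set
      In v K = Kernel S K × K v ≡ true

      pin : ∀ k {_ : True (1 ≤? k)} {_ : True (k ≤? 8)} {v} →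
            S v ≡ true → k ≤ suc (deg S v) → Few S (In v) (wt k)
      pin k {1≤k} {k≤8} Sv =
        Pin.few Sv Sv (λ _ → false) proj₁ proj₂ proj₂ (λ _ _ ()) (toWitness 1≤k) (toWitness k≤8)

      -- If `w` is a neighbour of `v`, no kernel contains both; otherwise `w` is the extra removed
      -- vertex.
      pin-two : ∀ k {_ : True (1 ≤? k)} {_ : True (k ≤? 8)} {v w} →
                S v ≡ true → S w ≡ true → w ≢ v → k ≤ 2 + deg S v →
                Few S (λ K → In v K × K w ≡ true) (wt k)
      pin-two k {1≤k} {k≤8} {v} {w} Sv Sw w≢v k≤ with true⊎false (N v w)
      ... | inj₂ Nw = few-extra Sw (Nw⇒D w (N-self w)) Nw (toWitness 1≤k) (toWitness k≤8) k≤
        where open Pin Sv Sw (λ _ → false) (proj₁ ∘ proj₁) (proj₂ ∘ proj₁) proj₂ (λ _ _ ())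
      ... | inj₁ Nw with N-cases Nw
      ...   | inj₁ w≡v = contradiction w≡v w≢v
      ...   | inj₂ a   = few-∅ λ ((ker , Kv) , Kw) → true≢false Kw (kernel-adj ker Sv Sw Kv a)

      pin-out : ∀ k {_ : True (1 ≤? k)} {_ : True (k ≤? 8)} {v a} →
                S v ≡ true → S a ≡ true → N v a ≡ false → k ≤ 2 + deg S v →
                Few S (λ K → In v K × K a ≡ false) (wt k)
      pin-out k {1≤k} {k≤8} {v} {a} Sv Sa Na = few-extra Sa (X⇒D a (⁅⁆-self a)) Na (toWitness 1≤k) (toWitness k≤8)
        where
        Q : (Fin n → Bool) → Set
        Q K = In v K × K a ≡ false
        a-out : ∀ {K} x → Q K → ⁅ a ⁆ x ≡ true → K x ≡ false
        a-out {K} x (_ , Ka) x∈ = trans (cong K (⁅⁆-≡ x x∈)) Ka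
        open Pin {v} {v} Sv Sv ⁅ a ⁆ {Q} (proj₁ ∘ proj₁) (proj₂ ∘ proj₁) (proj₂ ∘ proj₁) a-out

      -- Nothing dominates a source, so every kernel contains it and there is a single branch.
      source : ∀ {v} → S v ≡ true → indeg S v ≡ 0 → Good S
      source {v} Sv in≡0 = few⇒good (few-map isIn (pin 1 Sv (s≤s z≤n))) w₁
        where
        isIn : ∀ {K} → Kernel S K → In v K
        isIn {K} ker with true⊎false (K v)
        ... | inj₁ Kv = ker , Kv
        ... | inj₂ Kv with dominated ker Sv Kv
        ...   | u , Su , e , _ = ⊥-elim (♯≡0⇒∉ (pred S v) in≡0 u (∧-intro Su e))

      keep : ∀ {u v} → S u ≡ true → u ≢ v → (S ∖ ⁅ v ⁆) u ≡ true
      keep Su u≢v = ∧-intro Su (not-false (⁅⁆-≢ u≢v))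

      -- The second hypothesis ensures that no vertex loses its dominator with `v`; the third
      -- recovers the value at `v` from the remaining graph.
      delete : ∀ {Q v} → S v ≡ true → (∀ {K} → Q K → Kernel S K) →
               (∀ {K x} → Q K → K v ≡ true → S x ≡ true → E v x ≡ true → ⊥) →
               (∀ {K K′} → Q K → Q K′ → (∀ u → (S ∖ ⁅ v ⁆) u ≡ true → K u ≡ K′ u) → K v ≡ K′ v) →
               Few S Q (wt 1)
      delete {Q} {v} Sv ker no-dom fixed =
        reduce (S ∖ ⁅ v ⁆) (s≤s z≤n) (s≤s z≤n) (≤-reflexive (trans (+-comm _ 1) (sym (♯-remove S Sv))))
          restrict determined
        where
        restrict : ∀ {K} → Q K → Kernel (S ∖ ⁅ v ⁆) K
        restrict q .independent Su Sx = independent (ker q) (proj₁ (∧-true Su)) (proj₁ (∧-true Sx))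
        restrict q .dominated {x} Sx Kx with proj₁ (∧-true {S x} Sx)
        ... | Sx′ with dominated (ker q) Sx′ Kx
        ... | u , Su , e , Ku = u , keep Su (λ { refl → no-dom q Ku Sx′ e }) , e , Ku
        determined : ∀ {K K′} → Q K → Q K′ → (∀ u → (S ∖ ⁅ v ⁆) u ≡ true → K u ≡ K′ u) →
                     ∀ u → S u ≡ true → K u ≡ K′ u
        determined q q′ agree u Su with u ≟ᶠ v
        ... | no u≢v   = agree u (keep Su u≢v)
        ... | yes refl = fixed q q′ agree

      -- A sink dominates nothing, and it lies in a kernel exactly when none of its predecessors
      -- does, so the other vertices determine it.
      sink : ∀ {v} → S v ≡ true → outdeg S v ≡ 0 → Good S
      sink {v} Sv out≡0 = few⇒good
        (delete Sv (λ ker → ker) (λ _ _ Sx e → ♯≡0⇒∉ (succ S v) out≡0 _ (∧-intro Sx e)) fixed) w₁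
        where
        clash : ∀ {K K′} → Kernel S K → Kernel S K′ → (∀ u → (S ∖ ⁅ v ⁆) u ≡ true → K u ≡ K′ u) →
                K v ≡ true → K′ v ≡ false → ⊥
        clash ker ker′ agree Kv K′v with dominated ker′ Sv K′v
        ... | u , Su , e , K′u =
          true≢false Kv (independent ker Su Sv e (trans (agree u (keep Su (E⇒≢ e))) K′u))
        fixed : ∀ {K K′} → Kernel S K → Kernel S K′ → (∀ u → (S ∖ ⁅ v ⁆) u ≡ true → K u ≡ K′ u) →
                K v ≡ K′ v
        fixed {K} {K′} ker ker′ agree with true⊎false (K v) | true⊎false (K′ v)
        ... | inj₁ p | inj₁ q = trans p (sym q)
        ... | inj₂ p | inj₂ q = trans p (sym q)
        ... | inj₁ p | inj₂ q = ⊥-elim (clash ker ker′ agree p q)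
        ... | inj₂ p | inj₁ q = ⊥-elim (clash ker′ ker (λ x Sx → sym (agree x Sx)) q p)

      -- Kernels avoiding `v` lose one vertex, `v` itself; kernels containing it lose the closed
      -- neighbourhood, of size at least 8.
      large : ∀ {v} → S v ≡ true → 7 ≤ deg S v → Good S
      large {v} Sv 7≤d = few⇒good (few-⊎ outOrIn out (pin 8 Sv (s≤s 7≤d))) w₁₈
        where
        Out : (Fin n → Bool) → Set
        Out K = Kernel S K × K v ≡ false
        outOrIn : ∀ {K} → Kernel S K → Out K ⊎ In v K
        outOrIn {K} ker with true⊎false (K v)
        ... | inj₁ Kv = inj₂ (ker , Kv)
        ... | inj₂ Kv = inj₁ (ker , Kv)
        out : Few S Out (wt 1)
        out = delete Sv proj₁ (λ (_ , Kv≡false) Kv _ _ → true≢false Kv Kv≡false)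
                (λ (_ , Kv) (_ , K′v) _ → trans Kv (sym K′v))

      -- Either `v` or its only predecessor `u` is in the kernel, and each closed neighbourhood has
      -- at least 3 vertices. The fourth vertex for one branch comes from `deg S v ≥ 3` or from a
      -- second predecessor of `u`. Failing both, `v` in the kernel keeps `u` out and so forces in
      -- the only predecessor `w` of `u`.
      one-pred : (∀ {u} → S u ≡ true → 1 ≤ indeg S u) → (∀ {u} → S u ≡ true → 1 ≤ outdeg S u) →
                 ∀ {v} → S v ≡ true → indeg S v ≡ 1 → Good S
      one-pred ins outs {v} Sv in≡1 with exactly-one (pred S v) in≡1
      ... | u , pu , only with ∧-true {S u} pu
      ... | Su , e = result
        where
        2≤deg : ∀ {x} → S x ≡ true → 2 ≤ deg S x
        2≤deg Sx = +-mono-≤ (ins Sx) (outs Sx)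
        inv⊎inu : ∀ {K} → Kernel S K → In v K ⊎ In u K
        inv⊎inu {K} ker with true⊎false (K v)
        ... | inj₁ Kv = inj₁ (ker , Kv)
        ... | inj₂ Kv with dominated ker Sv Kv
        ...   | x , Sx , xe , Kx with only x (∧-intro Sx xe)
        ...     | refl = inj₂ (ker , Kx)
        inu⊎inv : ∀ {K} → Kernel S K → In u K ⊎ In v K
        inu⊎inv ker with inv⊎inu ker
        ... | inj₁ q = inj₂ q
        ... | inj₂ q = inj₁ q
        result : Good S
        result with 3 ≤? deg S v
        ... | yes 3≤d = few⇒good (few-⊎ inu⊎inv (pin 3 Su (s≤s (2≤deg Su))) (pin 4 Sv (s≤s 3≤d))) w₃₄
        ... | no  _ with 2 ≤? indeg S u
        ...   | yes 2≤in = few⇒good (few-⊎ inv⊎inu (pin 3 Sv (s≤s (2≤deg Sv)))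
                             (pin 4 Su (s≤s (+-mono-≤ 2≤in (outs Su))))) w₃₄
        ...   | no  2≰in with exactly-one (pred S u) (≤-antisym (s≤s⁻¹ (≰⇒> 2≰in)) (ins Su))
        ...     | w , pw , only′ with ∧-true {S w} pw
        ...       | Sw , we = few⇒good (few-⊎ inu⊎inv (pin 3 Su (s≤s (2≤deg Su)))
                                (few-map forced (pin-two 4 Sv Sw w≢v (s≤s (s≤s (2≤deg Sv)))))) w₃₄
          where
          w≢v : w ≢ v
          w≢v refl = true≢false we (asym e)
          forced : ∀ {K} → In v K → In v K × K w ≡ true
          forced {K} (ker , Kv) with true⊎false (K u)
          ... | inj₁ Ku = ⊥-elim (true≢false Kv (independent ker Su Sv e Ku))
          ... | inj₂ Ku with dominated ker Su Ku
          ...   | x , Sx , xe , Kx with only′ x (∧-intro Sx xe)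
          ...     | refl = (ker , Kv) , Kx

      -- Vertices with two or three predecessors

      module TwoPreds {v a b : Fin n} (Sv : S v ≡ true) (Sa : S a ≡ true) (Sb : S b ≡ true)
                      (av : E a v ≡ true) (bv : E b v ≡ true) (b≢a : b ≢ a)
                      (only : ∀ x → pred S v x ≡ true → x ≡ a ⊎ x ≡ b) where

        some-pred : ∀ {K} → Kernel S K → K v ≡ false → In a K ⊎ In b K
        some-pred ker Kv with dominated ker Sv Kv
        ... | x , Sx , e , Kx with only x (∧-intro Sx e)
        ...   | inj₁ refl = inj₁ (ker , Kx)
        ...   | inj₂ refl = inj₂ (ker , Kx)

        in⊎pred : ∀ {K} → Kernel S K → In v K ⊎ (In a K ⊎ In b K)
        in⊎pred {K} ker with true⊎false (K v)
        ... | inj₁ Kv = inj₁ (ker , Kv)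
        ... | inj₂ Kv = inj₂ (some-pred ker Kv)

        three-way : ∀ {w₁ w₂ w₃} → Few S (In v) w₁ → Few S (In a) w₂ → Few S (In b) w₃ →
                    Few S (Kernel S) (w₁ + (w₂ + w₃))
        three-way fv fa fb = few-⊎ in⊎pred fv (few-⊎ (λ q → q) fa fb)

        -- Kernels containing both `a` and `b` are counted in the branch of `a`. The branch of `b`
        -- may then assume that `a` is out, which removes one more vertex because `a` is not
        -- adjacent to `b`.
        three-way-nonadjacent : ∀ {w₁ w₂} k {_ : True (1 ≤? k)} {_ : True (k ≤? 8)} → N b a ≡ false →
          Few S (In v) w₁ → Few S (In a) w₂ → k ≤ 2 + deg S b → Few S (Kernel S) (w₁ + (w₂ + wt k))
        three-way-nonadjacent k {p} {q} Na fv fa k≤ =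
          few-⊎ in⊎pred fv (few-⊎ split fa (pin-out k {p} {q} Sb Sa Na k≤))
          where
          split : ∀ {K} → In a K ⊎ In b K → In a K ⊎ (In b K × K a ≡ false)
          split (inj₁ h) = inj₁ h
          split {K} (inj₂ (ker , Kb)) with true⊎false (K a)
          ... | inj₁ Ka = inj₁ (ker , Ka)
          ... | inj₂ Ka = inj₂ ((ker , Kb) , Ka)

        -- If a → b and b has a single further predecessor c, then v ∈ K excludes a and b and so forces c ∈ K.
        pin-chain : E a b ≡ true → indeg S b ≡ 2 → ∀ k {_ : True (1 ≤? k)} {_ : True (k ≤? 8)} →
                    k ≤ 2 + deg S v → Few S (In v) (wt k)
        pin-chain ab in≡2 k {p} {q} k≤
          with exactly-one (pred S b ∖ ⁅ a ⁆)
                 (suc-injective (trans (sym (♯-remove (pred S b) {a} (∧-intro Sa ab))) in≡2))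
        ... | c , pc , only-c with ∖-≢ {p = pred S b} {a} {c} pc
        ... | pc′ , c≢a with ∧-true {S c} pc′
        ... | Sc , cb = few-map forced (pin-two k {p} {q} Sv Sc (λ { refl → true≢false cb (asym bv) }) k≤)
          where
          out : ∀ {K x} → In v K → S x ≡ true → E x v ≡ true → K x ≡ false
          out {K} {x} (ker , Kv) Sx xv with true⊎false (K x)
          ... | inj₁ Kx = ⊥-elim (true≢false Kv (independent ker Sx Sv xv Kx))
          ... | inj₂ Kx = Kx
          forced : ∀ {K} → In v K → In v K × K c ≡ true
          forced h@(ker , Kv) with dominated ker Sb (out h Sb bv)
          ... | x , Sx , xb , Kx with x ≟ᶠ a
          ...   | yes refl = ⊥-elim (true≢false Kx (out h Sa av))
          ...   | no  x≢a with only-c x (∧-intro (∧-intro Sx xb) (not-false (⁅⁆-≢ x≢a)))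
          ...     | refl = h , Kx

        -- The successors `v` and `b` of `a` are distinct because of the arc from `b` to `v`.
        2≤outdeg : E a b ≡ true → 2 ≤ outdeg S a
        2≤outdeg ab = 2≤♯ (succ S a) (∧-intro Sv av) (∧-intro Sb ab) (λ { refl → true≢false bv irrefl })

      module MinDegree (ins : ∀ {u} → S u ≡ true → 2 ≤ indeg S u) (outs : ∀ {u} → S u ≡ true → 1 ≤ outdeg S u) where

        3≤deg : ∀ {u} → S u ≡ true → 3 ≤ deg S u
        3≤deg Su = +-mono-≤ (ins Su) (outs Su)

        record Pair (v a b : Fin n) : Set where
          constructor pair
          field
            Sa   : S a ≡ true
            Sb   : S b ≡ true
            av   : E a v ≡ true
            bv   : E b v ≡ true
            b≢a  : b ≢ a
            only : ∀ x → pred S v x ≡ true → x ≡ a ⊎ x ≡ b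

        swap : ∀ {v a b} → Pair v a b → Pair v b a
        swap (pair Sa Sb av bv b≢a only) = pair Sb Sa bv av (b≢a ∘ sym) λ x px → case only x px of λ where
          (inj₁ e) → inj₂ e
          (inj₂ e) → inj₁ e

        preds : ∀ {v} → indeg S v ≡ 2 → ∃₂ (Pair v)
        preds {v} in≡2 with exactly-two (pred S v) in≡2
        ... | a , b , pa , pb , b≢a , only with ∧-true {S a} pa | ∧-true {S b} pb
        ... | Sa , av | Sb , bv = a , b , pair Sa Sb av bv b≢a only

        data Adjacency (a b : Fin n) : Set where
          apart    : N b a ≡ false → Adjacency a b
          forward  : E a b ≡ true → Adjacency a b
          backward : E b a ≡ true → Adjacency a b

        adjacency : ∀ {v a b} → Pair v a b → Adjacency a b
        adjacency {a = a} {b} p with true⊎false (N b a)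
        ... | inj₂ Na = apart Na
        ... | inj₁ Na with N-cases {b} {a} Na
        ...   | inj₁ a≡b = contradiction (sym a≡b) (Pair.b≢a p)
        ...   | inj₂ h with adj-cases {a} {b} h
        ...     | inj₁ ab = forward ab
        ...     | inj₂ ba = backward ba

        indeg-cases : ∀ {u} → S u ≡ true → indeg S u ≡ 2 ⊎ 3 ≤ indeg S u
        indeg-cases {u} Su with 3 ≤? indeg S u
        ... | yes 3≤in = inj₂ 3≤in
        ... | no  3≰in = inj₁ (≤-antisym (s≤s⁻¹ (≰⇒> 3≰in)) (ins Su))

        -- The branch of `v` removes 7 vertices, and those of `a` and `b` at least 4 each. One of
        -- the latter reaches 5: with an arc between `a` and `b`, its tail has out-degree at least 2
        -- and hence degree at least 4; without one, the exclusion of `a` helps the branch of `b`.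
        two-preds-deg6 : ∀ {v} → S v ≡ true → indeg S v ≡ 2 → 6 ≤ deg S v → Good S
        two-preds-deg6 {v} Sv in≡2 6≤d with preds in≡2
        ... | a , b , p = result (adjacency p)
          where
          adjacent : ∀ {a b} → Pair v a b → E a b ≡ true → Good S
          adjacent (pair Sa Sb av bv b≢a only) ab = few⇒good
            (three-way (pin 7 Sv (s≤s 6≤d)) (pin 5 Sa (s≤s (+-mono-≤ (ins Sa) (2≤outdeg ab)))) (pin 4 Sb (s≤s (3≤deg Sb)))) w₇₅₄
            where open TwoPreds Sv Sa Sb av bv b≢a only
          result : Adjacency a b → Good S
          result (forward ab)  = adjacent p ab
          result (backward ba) = adjacent (swap p) ba
          result (apart Na)    = few⇒good
            (three-way-nonadjacent 5 Na (pin 7 Sv (s≤s 6≤d)) (pin 4 Sa (s≤s (3≤deg Sa))) (s≤s (s≤s (3≤deg Sb)))) w₇₄₅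
            where
            open Pair p
            open TwoPreds Sv Sa Sb av bv b≢a only

        -- Without an arc between the predecessors, let `a` be the one of degree at least 4: the
        -- branches remove 6, 5 and 4 + 1 vertices. With an arc from `a` to `b`, the branch of `a`
        -- removes 5. If `b` has in-degree 2, `pin-chain` raises the branch of `v` to 7 against 4
        -- for `b`; otherwise `b` has degree at least 4, giving 6, 5, 5.
        two-preds-deg5 : ∀ {v u} → S v ≡ true → indeg S v ≡ 2 → 5 ≤ deg S v →
                         S u ≡ true → E u v ≡ true → 4 ≤ deg S u → Good S
        two-preds-deg5 {v} {u} Sv in≡2 5≤d Su uv 4≤d with preds in≡2
        ... | a , b , p = dispatch (Pair.only p u (∧-intro Su uv))
          where
          adjacent : ∀ {a b} → Pair v a b → E a b ≡ true → Good S
          adjacent (pair Sa Sb av bv b≢a only) ab = cases (indeg-cases Sb)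
            where
            open TwoPreds Sv Sa Sb av bv b≢a only
            fa : Few S (In _) (wt 5)
            fa = pin 5 Sa (s≤s (+-mono-≤ (ins Sa) (2≤outdeg ab)))
            cases : indeg S _ ≡ 2 ⊎ 3 ≤ indeg S _ → Good S
            cases (inj₁ in≡2) = few⇒good (three-way (pin-chain ab in≡2 7 (s≤s (s≤s 5≤d))) fa (pin 4 Sb (s≤s (3≤deg Sb)))) w₇₅₄
            cases (inj₂ 3≤in) = few⇒good (three-way (pin 6 Sv (s≤s 5≤d)) fa (pin 5 Sb (s≤s (+-mono-≤ 3≤in (outs Sb))))) w₆₅₅
          result : ∀ {a b} → Pair v a b → 4 ≤ deg S a → Adjacency a b → Good S
          result p 4≤a (forward ab)  = adjacent p ab
          result p 4≤a (backward ba) = adjacent (swap p) ba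
          result p 4≤a (apart Na)    = few⇒good
            (three-way-nonadjacent 5 Na (pin 6 Sv (s≤s 5≤d)) (pin 5 Sa (s≤s 4≤a)) (s≤s (s≤s (3≤deg Sb)))) w₆₅₅
            where
            open Pair p
            open TwoPreds Sv Sa Sb av bv b≢a only
          dispatch : u ≡ a ⊎ u ≡ b → Good S
          dispatch (inj₁ refl) = result p 4≤d (adjacency p)
          dispatch (inj₂ refl) = result (swap p) 4≤d (adjacency (swap p))

        module Balanced (balanced : ∀ {u} → S u ≡ true → outdeg S u ≡ indeg S u) where

          2k≤deg : ∀ {u k} → S u ≡ true → k ≤ indeg S u → k + k ≤ deg S u
          2k≤deg Su k≤ = +-mono-≤ k≤ (subst (_ ≤_) (sym (balanced Su)) k≤)

          4≤deg : ∀ {u} → S u ≡ true → 4 ≤ deg S u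
          4≤deg Su = 2k≤deg Su (ins Su)

          -- Balance makes all degrees at least 4, so each branch removes 5 vertices. A sixth comes
          -- from the exclusion of `a` if `a` and `b` are not adjacent. If there is an arc from `a`
          -- to `b`, it comes from `pin-chain` when `b` has in-degree 2, and from the degree of `b`
          -- when its in-degree is at least 3.
          two-preds-balanced : ∀ {v} → S v ≡ true → indeg S v ≡ 2 → Good S
          two-preds-balanced {v} Sv in≡2 with preds in≡2
          ... | a , b , p = result (adjacency p)
            where
            pin₅ : ∀ {u} → S u ≡ true → Few S (In u) (wt 5)
            pin₅ Su = pin 5 Su (s≤s (4≤deg Su))
            adjacent : ∀ {a b} → Pair v a b → E a b ≡ true → Good S
            adjacent (pair Sa Sb av bv b≢a only) ab = cases (indeg-cases Sb)
              where
              open TwoPreds Sv Sa Sb av bv b≢a only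
              cases : indeg S _ ≡ 2 ⊎ 3 ≤ indeg S _ → Good S
              cases (inj₁ in≡2) = few⇒good (three-way (pin-chain ab in≡2 6 (s≤s (s≤s (4≤deg Sv)))) (pin₅ Sa) (pin₅ Sb)) w₆₅₅
              cases (inj₂ 3≤in) = few⇒good (three-way (pin₅ Sv) (pin₅ Sa) (pin 6 Sb (≤-trans (n≤1+n 6) (s≤s (2k≤deg Sb 3≤in))))) w₅₅₆
            result : Adjacency a b → Good S
            result (forward ab)  = adjacent p ab
            result (backward ba) = adjacent (swap p) ba
            result (apart Na)    = few⇒good
              (three-way-nonadjacent 6 Na (pin₅ Sv) (pin₅ Sa) (s≤s (s≤s (4≤deg Sb)))) w₅₅₆
              where
              open Pair p
              open TwoPreds Sv Sa Sb av bv b≢a only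

          -- Balance makes all degrees at least 6, so pinning `v` or any of its three predecessors
          -- removes 7 vertices.
          three-preds : (∀ {u} → S u ≡ true → 3 ≤ indeg S u) → ∀ {v} → S v ≡ true → indeg S v ≡ 3 → Good S
          three-preds ins₃ {v} Sv in≡3 with exactly-three (pred S v) in≡3
          ... | a , b , c , pa , pb , pc , only =
            few⇒good (few-⊎ cases (pin₇ Sv) (few-⊎ (λ q → q) (pin₇ (proj₁ (∧-true pa)))
              (few-⊎ (λ q → q) (pin₇ (proj₁ (∧-true pb))) (pin₇ (proj₁ (∧-true pc)))))) w₇₇₇₇
            where
            pin₇ : ∀ {u} → S u ≡ true → Few S (In u) (wt 7)
            pin₇ Su = pin 7 Su (s≤s (2k≤deg Su (ins₃ Su)))
            cases : ∀ {K} → Kernel S K → In v K ⊎ (In a K ⊎ (In b K ⊎ In c K))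
            cases {K} ker with true⊎false (K v)
            ... | inj₁ Kv = inj₁ (ker , Kv)
            ... | inj₂ Kv with dominated ker Sv Kv
            ...   | x , Sx , e , Kx with only x (∧-intro Sx e)
            ...     | inj₁ refl        = inj₂ (inj₁ (ker , Kx))
            ...     | inj₂ (inj₁ refl) = inj₂ (inj₂ (inj₁ (ker , Kx)))
            ...     | inj₂ (inj₂ refl) = inj₂ (inj₂ (inj₂ (ker , Kx)))

      -- Combining the cases

      search : ∀ {P : Fin n → Set} → (∀ v → Dec (P v)) →
               (∃ λ v → S v ≡ true × P v) ⊎ (∀ {v} → S v ≡ true → ¬ P v)
      search P? with any? (λ v → (S v ≟ᵇ true) ×-dec P? v)
      ... | yes h = inj₁ h
      ... | no ¬h = inj₂ λ {v} Sv Pv → ¬h (v , Sv , Pv)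

      -- No two sets differ on an empty vertex set, so the list has at most one entry.
      empty : (∀ v → S v ≡ true → ⊥) → Good S
      empty none []          _             _ = z≤n
      empty none (_ ∷ [])    _             _ = subst (_≤ B ^ ♯ S) (sym (+-identityʳ _)) (^-monoˡ-≤ (♯ S) A≤B)
      empty none (_ ∷ _ ∷ _) ((d ∷ _) ∷ _) _ = ⊥-elim (d (λ v Sv → ⊥-elim (none v Sv)))

      step : Good S
      step with search (λ v → indeg S v ≟ 0)
      ... | inj₁ (v , Sv , in≡0) = source Sv in≡0
      ... | inj₂ in≢0 with search (λ v → outdeg S v ≟ 0)
      ... | inj₁ (v , Sv , out≡0) = sink Sv out≡0
      ... | inj₂ out≢0 with search (λ v → indeg S v ≟ 1)
      ... | inj₁ (v , Sv , in≡1) = one-pred (n≢0⇒n>0 ∘ in≢0) (n≢0⇒n>0 ∘ out≢0) Sv in≡1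
      ... | inj₂ in≢1 with search (λ v → 7 ≤? deg S v)
      ... | inj₁ (v , Sv , 7≤d) = large Sv 7≤d
      ... | inj₂ 7≰d = dense
        where
        outs : ∀ {u} → S u ≡ true → 1 ≤ outdeg S u
        outs Su = n≢0⇒n>0 (out≢0 Su)
        ins : ∀ {u} → S u ≡ true → 2 ≤ indeg S u
        ins Su = ≤∧≢⇒< (n≢0⇒n>0 (in≢0 Su)) (in≢1 Su ∘ sym)
        open MinDegree ins outs
        dense : Good S
        dense with search (λ v → (indeg S v ≟ 2) ×-dec (6 ≤? deg S v))
        ... | inj₁ (v , Sv , in≡2 , 6≤d) = two-preds-deg6 Sv in≡2 6≤d
        ... | inj₂ ¬6 with search (λ v → (indeg S v ≟ 2) ×-dec ((5 ≤? deg S v) ×-dec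
                             any? (λ u → (S u ≟ᵇ true) ×-dec ((E u v ≟ᵇ true) ×-dec (4 ≤? deg S u)))))
        ... | inj₁ (v , Sv , in≡2 , 5≤d , u , Su , uv , 4≤d) = two-preds-deg5 Sv in≡2 5≤d Su uv 4≤d
        ... | inj₂ ¬5 = result
          where
          -- The degree bounds for discharging are the failures of the preceding searches.
          open Discharging S ins outs (λ Sv → s≤s⁻¹ (≰⇒> (7≰d Sv)))
            (λ Sv in≡2 → s≤s⁻¹ (≰⇒> (λ 6≤d → ¬6 Sv (in≡2 , 6≤d))))
            (λ Sv in≡2 5≤d Su uv → s≤s⁻¹ (≰⇒> (λ 4≤d → ¬5 Sv (in≡2 , 5≤d , _ , Su , uv , 4≤d))))
            using (balanced)
          open Balanced balanced
          result : Good S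
          result with search (λ v → indeg S v ≟ 2)
          ... | inj₁ (v , Sv , in≡2) = two-preds-balanced Sv in≡2
          ... | inj₂ in≢2 with any? (λ v → S v ≟ᵇ true)
          ...   | no  none     = empty λ v Sv → none (v , Sv)
          ...   | yes (v , Sv) = three-preds 3≤in Sv (≤-antisym (s≤s⁻¹ (≰⇒> 4≰in)) (3≤in Sv))
            where
            3≤in : ∀ {u} → S u ≡ true → 3 ≤ indeg S u
            3≤in Su = ≤∧≢⇒< (ins Su) (in≢2 Su ∘ sym)
            -- By balance, in-degree 4 would give degree 8, which `7≰d` excludes.
            4≰in : ¬ 4 ≤ indeg S v
            4≰in 4≤in = 7≰d Sv (≤-trans (n≤1+n 7) (2k≤deg Sv 4≤in))

    all-good : ∀ m S → ♯ S < m → Good S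
    all-good (suc m) S lt = Step.step S λ S′ lt′ → all-good m S′ (≤-trans lt′ (s≤s⁻¹ lt))

    kernel-bound : ∀ S → Good S
    kernel-bound S = all-good (suc (♯ S)) S ≤-refl

-- From stable models to kernels

All-mapMaybe⁻ : ∀ {X Y : Set} {Q : Y → Set} {f : X → Maybe Y} {xs x y} →
                All Q (mapMaybe f xs) → x ∈ xs → f x ≡ just y → Q y
All-mapMaybe⁻ {f = f} {x ∷ xs} qs (here refl) eq with f x
All-mapMaybe⁻ (q ∷ qs) (here refl) refl | just _ = q
All-mapMaybe⁻ {f = f} {x ∷ xs} qs (there x∈) eq with f x
All-mapMaybe⁻ (q ∷ qs) (there x∈) eq | just _  = All-mapMaybe⁻ qs x∈ eq
All-mapMaybe⁻ qs       (there x∈) eq | nothing = All-mapMaybe⁻ qs x∈ eq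

All-mapMaybe⁺ : ∀ {X Y : Set} {Q : Y → Set} {f : X → Maybe Y} xs →
                (∀ {x y} → x ∈ xs → f x ≡ just y → Q y) → All Q (mapMaybe f xs)
All-mapMaybe⁺ [] h = []
All-mapMaybe⁺ {f = f} (x ∷ xs) h with f x in eq
... | just y  = h (here refl) eq ∷ All-mapMaybe⁺ xs (h ∘ there)
... | nothing = All-mapMaybe⁺ xs (h ∘ there)

lookup-ext : ∀ {X : Set} {n} {xs ys : Vec X n} → (∀ i → lookup xs i ≡ lookup ys i) → xs ≡ ys
lookup-ext {xs = xs} {ys} h = trans (sym (tabulate∘lookup xs)) (trans (tabulate-cong h) (tabulate∘lookup ys))

_≟ˡ_ : ∀ {n} → DecidableEquality (Lit n)
pos a ≟ˡ pos b = map′ (cong pos) (λ { refl → refl }) (a ≟ᶠ b)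
pos a ≟ˡ neg b = no λ ()
neg a ≟ˡ pos b = no λ ()
neg a ≟ˡ neg b = map′ (cong neg) (λ { refl → refl }) (a ≟ᶠ b)

_≟ᶜ_ : ∀ {n} → DecidableEquality (Clause n)
(h ← B) ≟ᶜ (h′ ← B′) = map′ (λ { (refl , refl) → refl }) (λ { refl → refl , refl })
  (Maybe.≡-dec _≟ᶠ_ h h′ ×-dec List.≡-dec _≟ˡ_ B B′)

data Shape {n} : Clause n → Set where
  fact : ∀ p → Shape (just p ← [])
  rule : ∀ p u → Shape (just p ← (neg u ∷ []))

shape : ∀ {n} (c : Clause n) → InClassClause c → Shape c
shape (just p ← [])          _                        = fact p
shape (just p ← (_ ∷ []))    (_ , (u , refl) ∷ [])    = rule p u
shape (just p ← (_ ∷ _ ∷ _)) (s≤s () , _)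

module _ {n : ℕ} (P : Program n) (inClass : InP2n P) where

  open DecMembership (_≟ᶜ_ {n}) using (_∈?_)

  isClause : Clause n → Bool
  isClause c = does (c ∈? P)

  clause-∈ : ∀ c → isClause c ≡ true → c ∈ P
  clause-∈ c = does-true (c ∈? P)

  ∈-clause : ∀ c → c ∈ P → isClause c ≡ true
  ∈-clause c = dec-true (c ∈? P)

  factOf : Fin n → Clause n
  factOf v = just v ← []

  ruleOf : Fin n → Fin n → Clause n
  ruleOf u v = just v ← (neg u ∷ [])

  -- Facts and atoms v with a rule v ← not(v) belong to every stable model.
  Free : Fin n → Bool
  Free v = not (isClause (factOf v)) ∧ not (isClause (ruleOf v v))

  -- Requiring the head of an arc to be free rules out loops; between distinct atoms, asymmetry is
  -- the absence of dual pairs.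
  Edge : Fin n → Fin n → Bool
  Edge u v = Free v ∧ isClause (ruleOf u v)

  Edge-asym : ∀ {u v} → Edge u v ≡ true → Edge v u ≡ false
  Edge-asym {u} {v} uv with true⊎false (Edge v u)
  ... | inj₂ vu = vu
  ... | inj₁ vu with ∧-true {Free v} uv | ∧-true {Free u} vu | u ≟ᶠ v
  ...   | Fv , cuv | _ , cvu | yes refl = ⊥-elim (true≢false cuv (not-true (proj₂ (∧-true {not (isClause (factOf v))} Fv))))
  ...   | Fv , cuv | _ , cvu | no u≢v   =
    ⊥-elim (proj₂ inClass u v u≢v (clause-∈ (ruleOf v u) cvu , clause-∈ (ruleOf u v) cuv))

  open Graph Edge Edge-asym

  complement : Subset n → Fin n → Bool
  complement M v = not (lookup M v)

  module StableModel {M : Subset n} (stable : Stable P M) where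

    mem≡lookup : ∀ a → mem a M ≡ lookup M a
    mem≡lookup a with lookup M a
    ... | true  = refl
    ... | false = refl

    reductClause-unblocked : ∀ h B → blocked M B ≡ false → reductClause M (h ← B) ≡ just (h ⇐ positives B)
    reductClause-unblocked h B eq rewrite eq = refl

    blocked-rule : ∀ u → blocked M (neg u ∷ []) ≡ lookup M u
    blocked-rule u rewrite mem≡lookup u with lookup M u
    ... | true  = refl
    ... | false = refl

    -- In the reduct such a clause becomes a fact, and `M` is a model of the reduct.
    fires : ∀ {p B} → (just p ← B) ∈ P → blocked M B ≡ false → positives B ≡ [] → lookup M p ≡ true
    fires {p} {B} c∈ unblocked none =
      []=⇒lookup (All-mapMaybe⁻ (proj₁ stable) c∈ (reductClause-unblocked (just p) B unblocked)
        (subst (All (Subset._∈ M)) (sym none) []))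

    fact-holds : ∀ {p} → factOf p ∈ P → lookup M p ≡ true
    fact-holds c∈ = fires c∈ refl refl

    rule-holds : ∀ {u p} → ruleOf u p ∈ P → lookup M u ≡ false → lookup M p ≡ true
    rule-holds {u} c∈ Mu = fires c∈ (trans (blocked-rule u) Mu) refl

    -- A fact puts `v` into `M`; so does the rule `v ← not(v)`, which is unblocked when `v` is not
    -- in `M`.
    out⇒free : ∀ {v} → lookup M v ≡ false → Free v ≡ true
    out⇒free {v} Mv = ∧-intro (absent (factOf v) fact-holds) (absent (ruleOf v v) (λ c∈ → rule-holds c∈ Mv))
      where
      absent : ∀ c → (c ∈ P → lookup M v ≡ true) → not (isClause c) ≡ true
      absent c h with true⊎false (isClause c)
      ... | inj₁ e = ⊥-elim (true≢false (h (clause-∈ c e)) Mv)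
      ... | inj₂ e = not-false e

    -- An atom without an unblocked clause could be removed from the least model of the reduct.
    supported : ∀ {v} → lookup M v ≡ true → ∃ λ c → c ∈ P × head c ≡ just v × blocked M (body c) ≡ false
    supported {v} Mv with Any.any? (λ c → Maybe.≡-dec _≟ᶠ_ (head c) (just v) ×-dec (blocked M (body c) ≟ᵇ false)) P
    ... | yes any = find any
    ... | no none = ⊥-elim (true≢false ([]=⇒lookup (proj₂ stable X X-model (lookup⇒[]= v M Mv))) (lookup∘update v M false))
      where
      X : Subset n
      X = M [ v ]≔ false
      -- By `none`, `v` heads no unblocked clause, so removing it from `M` leaves the heads of all
      -- unblocked clauses in place.
      kept : ∀ {p B} → (just p ← B) ∈ P → blocked M B ≡ false → positives B ≡ [] → lookup X p ≡ true
      kept c∈ unblocked no-pos =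
        trans (lookup∘update′ (λ { refl → none (lose c∈ (refl , unblocked)) }) M false) (fires c∈ unblocked no-pos)
      holds : ∀ {c d} → c ∈ P → Shape c → reductClause M c ≡ just d → ModelC X d
      holds {c} {d} c∈ sh eq with blocked M (body c) in unblocked
      holds c∈ sh () | true
      holds c∈ (fact p)   refl | false = λ _ → lookup⇒[]= p X (kept c∈ unblocked refl)
      holds c∈ (rule p u) refl | false = λ _ → lookup⇒[]= p X (kept c∈ unblocked refl)
      X-model : ModelP X (reduct M P)
      X-model = All-mapMaybe⁺ P λ {c} c∈ eq → holds c∈ (shape c (All.lookup (proj₁ inClass) c∈)) eq

    -- Independence: if `u` is not in `M`, the rule `v ← not(u)` puts `v` into `M`. Domination: a
    -- free `v` in `M` is supported by an unblocked clause that is not a fact, hence by some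
    -- `v ← not(u)` with `u` outside `M`; such a `u` is free.
    kernel : Kernel Free (complement M)
    kernel .independent {u} {v} _ _ e Ku = cong not (rule-holds (clause-∈ (ruleOf u v) (proj₂ (∧-true {Free v} e))) (not-true Ku))
    kernel .dominated {v} Fv Kv with supported {v} (trans (sym (not-involutive (lookup M v))) (cong not Kv))
    ... | c , c∈ , hd , unblocked with shape c (All.lookup (proj₁ inClass) c∈)
    kernel .dominated {v} Fv Kv | c , c∈ , refl , unblocked | fact v =
      ⊥-elim (true≢false (∈-clause c c∈) (not-true (proj₁ (∧-true Fv))))
    kernel .dominated {v} Fv Kv | c , c∈ , refl , unblocked | rule v u =
      u , out⇒free Mu , ∧-intro Fv (∈-clause c c∈) , not-false Mu
      where
      Mu : lookup M u ≡ false
      Mu = trans (sym (blocked-rule u)) unblocked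

    fixed : ∀ {v} → Free v ≡ false → lookup M v ≡ true
    fixed {v} Fv with true⊎false (lookup M v)
    ... | inj₁ Mv = Mv
    ... | inj₂ Mv = ⊥-elim (true≢false (out⇒free Mv) Fv)

  -- All stable models contain every atom that is not free, so distinct ones must differ at a free
  -- atom.
  complements-differ : ∀ {M M′} → Stable P M → Stable P M′ → M ≢ M′ → Differ Free (complement M) (complement M′)
  complements-differ {M} {M′} st st′ M≢M′ agree = M≢M′ (lookup-ext same)
    where
    same : ∀ v → lookup M v ≡ lookup M′ v
    same v with true⊎false (Free v)
    ... | inj₁ Fv = not-injective (agree v Fv)
    ... | inj₂ Fv = trans (StableModel.fixed st Fv) (sym (StableModel.fixed st′ Fv))

  stable-bound : ∀ (L : List (Subset n)) → Unique L → All (Stable P) L →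
                 length L * 100000 ^ n ≤ 1 * 123651 ^ n
  stable-bound L unique stables = begin
    length L * 100000 ^ n                                  ≡⟨ cong (λ k → length L * 100000 ^ k) (sym Free+rest) ⟩
    length L * 100000 ^ (♯ Free + rest)                    ≡⟨ cong (length L *_) (^-distribˡ-+-* 100000 (♯ Free) rest) ⟩
    length L * (100000 ^ ♯ Free * 100000 ^ rest)           ≡⟨ sym (*-assoc (length L) _ _) ⟩
    -- The atoms that are not free only weaken the bound, since 100000 ≤ 123651.
    length L * 100000 ^ ♯ Free * 100000 ^ rest             ≤⟨ *-mono-≤ free-bound (^-monoˡ-≤ rest A≤B) ⟩
    123651 ^ ♯ Free * 123651 ^ rest                        ≡⟨ sym (^-distribˡ-+-* 123651 (♯ Free) rest) ⟩
    123651 ^ (♯ Free + rest)                               ≡⟨ cong (123651 ^_) Free+rest ⟩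
    123651 ^ n                                             ≡⟨ sym (+-identityʳ _) ⟩
    1 * 123651 ^ n                                         ∎
    where
    open ≤-Reasoning
    A≤B : 100000 ≤ 123651
    A≤B = ≤ᵇ⇒≤ _ _ _
    rest : ℕ
    rest = n ∸ ♯ Free
    Free+rest : ♯ Free + rest ≡ n
    Free+rest = m+[n∸m]≡n (♯≤n Free)
    -- The six weight inequalities are checked by evaluation. The tightest is the one for (7,4,5),
    -- which dictates the constant 1.23651.
    open Branching 100000 123651 A≤B (≤ᵇ⇒≤ _ _ _) (≤ᵇ⇒≤ _ _ _) (≤ᵇ⇒≤ _ _ _) (≤ᵇ⇒≤ _ _ _) (≤ᵇ⇒≤ _ _ _) (≤ᵇ⇒≤ _ _ _)
      using (kernel-bound)
    free-bound : length L * 100000 ^ ♯ Free ≤ 123651 ^ ♯ Free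
    free-bound = subst (λ l → l * 100000 ^ ♯ Free ≤ 123651 ^ ♯ Free) (List.length-map complement L)
      (kernel-bound Free (map complement L)
        (AllPairs.map⁺ (AllPairs-map complements-differ stables unique))
        (All.map⁺ (All.map StableModel.kernel stables)))

theorem8 : Σ ℕ (λ C → ∀ (n : ℕ) (P : Program n) → InP2n P → AtomsExactly P →
    ∀ (L : List (Subset n)) → Unique L → All (Stable P) L →
    length L * 100000 ^ n ≤ C * 123651 ^ n)
theorem8 = 1 , λ n P inClass _ → stable-bound P inClass
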